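{- If $G$ and $H$ are connected graphs and $G\,\square\,H$ denotes their Cartesian product, then \[ \mathrm{gp}(G\,\square\,H)\ge \mathrm{gp}(G)+\mathrm{gp}(H)-2 . \]
   Context: Graphs are finite, undirected and simple. The Cartesian product $G\,\square\,H$ has vertex set $V(G)\times V(H)$, and $(g,h)$, $(g',h')$ are adjacent if either $gg'\in E(G)$ and $h=h'$, or $g=g'$ and $hh'\in E(H)$. For a graph $G$, $d_G$ is the shortest-path distance; a $u,v$-geodesic is a $u,v$-path of length $d_G(u,v)$. A set $S\subseteq V(G)$ is a general position set of $G$ if no vertex of $S$ lies on a geodesic between two other vertices of $S$. The general position number $\mathrm{gp}(G)$ is the maximum cardinality of a general position set of $G$. -}

module Defs where

open import Data.Empty using (⊥-elim)
open import Data.Fin using (Fin; zero; suc)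
import Data.Fin.Properties as Fin
open import Data.Fin.Subset using (Subset; ∣_∣) renaming (_∈_ to _∈ₛ_; ⊥ to ∅)
open import Data.Fin.Subset.Properties using (_∈?_; anySubset?; ∣p∣≤n; ∣⊥∣≡0; ∉⊥)
open import Data.List using (List; []; _∷_; lookup) renaming (length to ∣_∣ₗ)
open import Data.List.Membership.Propositional using (_∈_)
open import Data.List.Membership.Propositional.Properties using (∈-lookup)
import Data.List.Membership.DecPropositional as DecMembership
import Data.List.Relation.Unary.All as All
open import Data.List.Relation.Unary.AllPairs using (_∷_)
open import Data.List.Relation.Unary.Unique.Propositional using (Unique)
import Data.List.Relation.Unary.Unique.DecPropositional as DecUnique
open import Data.Nat using (ℕ; zero; suc; _*_; _≤_; _<_; z≤n; s≤s; s≤s⁻¹)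
import Data.Nat.Properties as ℕ
open import Data.Product using (Σ-syntax; ∃-syntax; _×_; _,_; proj₁; proj₂)
open import Data.Product.Function.NonDependent.Propositional using (_×-↔_)
open import Data.Sum using (_⊎_; inj₁; inj₂)
open import Function using (_∘_; _↔_; Inverse; Injective)
open import Function.Construct.Composition using (_↔-∘_)
open import Function.Construct.Symmetry using (↔-sym)
open import Function.Properties.Inverse using (↔⇒↣)
open import Relation.Binary using (Decidable; DecidableEquality; Symmetric)
open import Relation.Binary.Construct.Closure.ReflexiveTransitive using (Star; ε; _◅_)
open import Relation.Binary.PropositionalEquality
  using (_≡_; _≢_; refl; sym; trans; cong; subst)
open import Relation.Nullary using (¬_; Dec; yes; no; ¬?)
open import Relation.Nullary.Decidable
  using (map′; _×-dec_; _⊎-dec_; _→-dec_)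
import Relation.Unary as U

record Graph : Set₁ where
  infix 4 _~_ _~?_
  field
    V        : Set
    order    : ℕ
    finite   : V ↔ Fin order
    _~_      : V → V → Set
    _~?_     : Decidable _~_
    ~-sym    : Symmetric _~_
    ~-irrefl : ∀ v → ¬ (v ~ v)

  open Inverse finite public using ()
    renaming (to to index; from to vertex; strictlyInverseʳ to vertex-index)

  infix 4 _≟_
  _≟_ : DecidableEquality V
  _≟_ = Fin.inj⇒≟ (↔⇒↣ finite)

open Graph using (V; order; index)

infixr 7 _□_
_□_ : Graph → Graph → Graph
G □ H = record
  { V        = G.V × H.V
  ; order    = G.order * H.order
  ; finite   = ↔-sym Fin.*↔× ↔-∘ (G.finite ×-↔ H.finite)
  ; _~_      = λ (g , h) (g′ , h′) → (g G.~ g′ × h ≡ h′) ⊎ (g ≡ g′ × h H.~ h′)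
  ; _~?_     = λ (g , h) (g′ , h′) →
                 ((g G.~? g′) ×-dec (h H.≟ h′)) ⊎-dec ((g G.≟ g′) ×-dec (h H.~? h′))
  ; ~-sym    = λ { (inj₁ (a , e)) → inj₁ (G.~-sym a , sym e)
                 ; (inj₂ (e , a)) → inj₂ (sym e , H.~-sym a) }
  ; ~-irrefl = λ { (g , h) (inj₁ (a , _)) → G.~-irrefl g a
                 ; (g , h) (inj₂ (_ , a)) → H.~-irrefl h a }
  }
  where
  module G = Graph G
  module H = Graph H

module _ (G : Graph) where
  open Graph G using (_~_)

  Walk : V G → V G → Set
  Walk = Star _~_

module _ {G : Graph} where

  walkLength : ∀ {u v} → Walk G u v → ℕ
  walkLength ε       = 0
  walkLength (_ ◅ w) = suc (walkLength w)

  walkVertices : ∀ {u v} → Walk G u v → List (V G)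
  walkVertices {u} ε       = u ∷ []
  walkVertices {u} (_ ◅ w) = u ∷ walkVertices w

module _ (G : Graph) where

  Path : V G → V G → Set
  Path u v = Σ[ w ∈ Walk G u v ] Unique (walkVertices {G} w)

module _ {G : Graph} where

  length : ∀ {u v} → Path G u v → ℕ
  length (w , _) = walkLength {G} w

  vertices : ∀ {u v} → Path G u v → List (V G)
  vertices (w , _) = walkVertices {G} w

module _ (G : Graph) where

  -- The null graph is not connected.
  Connected : Set
  Connected = V G × (∀ u v → Path G u v)

  -- d_G(u,v) = d, as a relation: between different components there is no
  -- distance.
  IsDistance : V G → V G → ℕ → Set
  IsDistance u v d =
    (Σ[ p ∈ Path G u v ] length {G} p ≡ d) × (∀ (p : Path G u v) → d ≤ length {G} p)

  IsGeodesic : ∀ {u v} → Path G u v → Set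
  IsGeodesic {u} {v} p = IsDistance u v (length {G} p)

  LiesOnGeodesic : V G → V G → V G → Set
  LiesOnGeodesic w u v = Σ[ p ∈ Path G u v ] (IsGeodesic p × w ∈ vertices {G} p)

  -- Vertex sets are subsets of Fin (order G), read through the enumeration of
  -- V G, so that ∣_∣ is their cardinality.
  VertexSet : Set
  VertexSet = Subset (order G)

  infix 4 _∈ᵥ_
  _∈ᵥ_ : V G → VertexSet → Set
  v ∈ᵥ S = index G v ∈ₛ S

  IsGeneralPosition : VertexSet → Set
  IsGeneralPosition S =
    ∀ u v w → u ∈ᵥ S → v ∈ᵥ S → w ∈ᵥ S →
    u ≢ v → w ≢ u → w ≢ v → ¬ LiesOnGeodesic w u v

  IsGPNumber : ℕ → Set
  IsGPNumber k =
    (Σ[ S ∈ VertexSet ] (IsGeneralPosition S × ∣ S ∣ ≡ k)) ×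
    (∀ S → IsGeneralPosition S → ∣ S ∣ ≤ k)

private

  lookup-injective : ∀ {A : Set} {xs : List A} → Unique xs → Injective _≡_ _≡_ (lookup xs)
  lookup-injective (_ ∷ _)  {zero}  {zero}  _ = refl
  lookup-injective (x≢ ∷ _) {zero}  {suc j} e = ⊥-elim (All.lookup x≢ (∈-lookup j) e)
  lookup-injective (x≢ ∷ _) {suc i} {zero}  e = ⊥-elim (All.lookup x≢ (∈-lookup i) (sym e))
  lookup-injective (_ ∷ u)  {suc i} {suc j} e = cong suc (lookup-injective u e)

  greatest : {Q : ℕ → Set} → U.Decidable Q → Q 0 → ∀ n →
             ∃[ k ] (Q k × (∀ j → j ≤ n → Q j → j ≤ k))
  greatest Q? q₀ zero = 0 , q₀ , λ _ j≤0 _ → j≤0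
  greatest {Q} Q? q₀ (suc n) with Q? (suc n)
  ... | yes q = suc n , q , λ _ j≤n _ → j≤n
  ... | no ¬q with k , q , max ← greatest Q? q₀ n = k , q , bound
    where
    bound : ∀ j → j ≤ suc n → Q j → j ≤ k
    bound j j≤ qj with ℕ.m≤n⇒m<n∨m≡n j≤
    ... | inj₁ j<   = max j (s≤s⁻¹ j<) qj
    ... | inj₂ refl = ⊥-elim (¬q qj)

module _ (G : Graph) where
  open Graph G using (_~_; _~?_; _≟_; vertex; vertex-index)
  open DecMembership _≟_ using () renaming (_∈?_ to _∈ₗ?_)
  open DecUnique _≟_ using (unique?)

  private

    anyVertex? : {P : V G → Set} → U.Decidable P → Dec (Σ[ v ∈ V G ] P v)
    anyVertex? {P} P? = map′
      (λ (i , p) → vertex i , p)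
      (λ (v , p) → index G v , subst P (sym (vertex-index v)) p)
      (Fin.any? (P? ∘ vertex))

    allVertices? : {P : V G → Set} → U.Decidable P → Dec (∀ v → P v)
    allVertices? {P} P? = map′
      (λ f v → subst P (vertex-index v) (f (index G v)))
      (λ f i → f (vertex i))
      (Fin.all? (P? ∘ vertex))

    ∣unique∣≤order : ∀ {xs : List (V G)} → Unique xs → ∣ xs ∣ₗ ≤ order G
    ∣unique∣≤order {xs} u = Fin.injective⇒≤ {f = index G ∘ lookup xs}
      (λ e → lookup-injective u (trans (sym (vertex-index _)) (trans (cong vertex e) (vertex-index _))))

    ∣vertices∣ : ∀ {u v} (w : Walk G u v) → ∣ walkVertices {G} w ∣ₗ ≡ suc (walkLength {G} w)
    ∣vertices∣ ε       = refl
    ∣vertices∣ (_ ◅ w) = cong suc (∣vertices∣ w)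

    anyWalk≤? : ∀ n u v {Q : List (V G) → Set} → U.Decidable Q →
                Dec (Σ[ w ∈ Walk G u v ] (walkLength {G} w ≤ n × Q (walkVertices {G} w)))
    anyWalk≤? zero u v Q? with u ≟ v
    ... | no u≢v = no λ { (ε , _) → u≢v refl ; (_ ◅ _ , () , _) }
    ... | yes refl = map′ (λ q → ε , z≤n , q) (λ { (ε , _ , q) → q ; (_ ◅ _ , () , _) }) (Q? (u ∷ []))
    anyWalk≤? (suc n) u v {Q} Q? = map′ to from
      ((u ≟ v ×-dec Q? (u ∷ [])) ⊎-dec
       anyVertex? (λ x → (u ~? x) ×-dec anyWalk≤? n x v (Q? ∘ (u ∷_))))
      where
      W W′ : Set
      W = Σ[ w ∈ Walk G u v ] (walkLength {G} w ≤ suc n × Q (walkVertices {G} w))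
      W′ = (u ≡ v × Q (u ∷ [])) ⊎
           (Σ[ x ∈ V G ] ((u ~ x) ×
             (Σ[ w ∈ Walk G x v ] (walkLength {G} w ≤ n × Q (u ∷ walkVertices {G} w)))))
      to : W′ → W
      to (inj₁ (refl , q))              = ε , z≤n , q
      to (inj₂ (_ , a , w , w≤n , q))   = a ◅ w , s≤s w≤n , q
      from : W → W′
      from (ε , _ , q)                  = inj₁ (refl , q)
      from (a ◅ w , w≤n , q)            = inj₂ (_ , a , w , s≤s⁻¹ w≤n , q)

    anyPath? : ∀ u v {Q : List (V G) → Set} → U.Decidable Q →
               Dec (Σ[ p ∈ Path G u v ] Q (vertices {G} p))
    anyPath? u v {Q} Q? = map′
      (λ (w , _ , uniq , q) → (w , uniq) , q)
      (λ ((w , uniq) , q) → w , bound w uniq , uniq , q)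
      (anyWalk≤? (order G) u v {λ xs → Unique xs × Q xs} (λ xs → unique? xs ×-dec Q? xs))
      where
      bound : (w : Walk G u v) → Unique (walkVertices {G} w) → walkLength {G} w ≤ order G
      bound w uniq = ℕ.≤-trans (ℕ.n≤1+n _)
        (subst (_≤ order G) (∣vertices∣ w) (∣unique∣≤order uniq))

    Shorter : V G → V G → List (V G) → Set
    Shorter u v xs = Σ[ q ∈ Path G u v ] (∣ vertices {G} q ∣ₗ < ∣ xs ∣ₗ)

    geodesic⇒¬shorter : ∀ {u v} (p : Path G u v) → IsGeodesic G p → ¬ Shorter u v (vertices {G} p)
    geodesic⇒¬shorter (w , _) (_ , min) (q , q<p)
      rewrite ∣vertices∣ w | ∣vertices∣ (proj₁ q) = ℕ.≤⇒≯ (min q) (s≤s⁻¹ q<p)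

    ¬shorter⇒geodesic : ∀ {u v} (p : Path G u v) → ¬ Shorter u v (vertices {G} p) → IsGeodesic G p
    ¬shorter⇒geodesic p ¬s = (p , refl) , λ q → ℕ.≮⇒≥ λ q<p → ¬s (q ,
      subst (_ <_) (sym (∣vertices∣ (proj₁ p)))
        (subst (_< suc (length {G} p)) (sym (∣vertices∣ (proj₁ q))) (s≤s q<p)))

  liesOnGeodesic? : ∀ w u v → Dec (LiesOnGeodesic G w u v)
  liesOnGeodesic? w u v = map′
    (λ (p , ¬s , w∈p) → p , ¬shorter⇒geodesic p ¬s , w∈p)
    (λ (p , geo , w∈p) → p , geodesic⇒¬shorter p geo , w∈p)
    (anyPath? u v (λ xs →
      ¬? (anyPath? u v (λ ys → ∣ ys ∣ₗ ℕ.<? ∣ xs ∣ₗ)) ×-dec (w ∈ₗ? xs)))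

  isGeneralPosition? : U.Decidable (IsGeneralPosition G)
  isGeneralPosition? S =
    allVertices? λ u → allVertices? λ v → allVertices? λ w →
      (index G u ∈? S) →-dec (index G v ∈? S) →-dec (index G w ∈? S) →-dec
      ¬? (u ≟ v) →-dec ¬? (w ≟ u) →-dec ¬? (w ≟ v) →-dec ¬? (liesOnGeodesic? w u v)

  gpNumber-exists : ∃[ k ] IsGPNumber G k
  gpNumber-exists
    with k , q , max ← greatest
           (λ k → anySubset? (λ S → isGeneralPosition? S ×-dec (∣ S ∣ ℕ.≟ k)))
           (∅ , (λ _ _ _ u∈∅ → ⊥-elim (∉⊥ u∈∅)) , ∣⊥∣≡0 (order G))
           (order G)
    = k , q , λ S gpS → max ∣ S ∣ (∣p∣≤n S) (S , gpS , refl)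

  gp : ℕ
  gp = proj₁ gpNumber-exists

  gp-isGPNumber : IsGPNumber G gp
  gp-isGPNumber = proj₂ gpNumber-exists

{-# OPTIONS --safe #-}

-- Let R and S be maximum general position sets of G and H, and fix g ∈ R and
-- h ∈ S.  The cross (R ∖ g) × {h} ∪ {g} × (S ∖ h) has gp G + gp H − 2 vertices.
-- It is in general position: a shortest walk of G □ H projects to shortest
-- walks of both factors, so if w lies on a u,v-geodesic then each coordinate of
-- w lies on a geodesic between the corresponding coordinates of u and v, hence
-- equals one of them.  In the coordinate of w that is not g or h this forces
-- w = u or w = v.
module Submission where

open import Defs
open import Data.Fin using (Fin; zero; suc)
open import Data.Fin.Properties using (0≢1+n; suc-injective)
open import Data.Fin.Subset
  using (Subset; ∣_∣; _∈_; _∉_; _⊆_; _-_; ⁅_⁆; Nonempty; inside; outside; ⊥)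
open import Data.Fin.Subset.Properties
  using (_∈?_; nonempty?; Empty-unique; ∉⊥; ⊥⊆; ∣⊥∣≡0; ∣⁅x⁆∣≡1; x∈⁅y⁆⇒x≡y; p─⊥≡p; p─q⊆p;
         p─q─q≡p─q; p⊆q⇒∣p∣≤∣q∣; x∈p∧x≢y⇒x∈p-y; x∈p⇒∣p-x∣<∣p∣)
open import Data.List using ([]; _∷_)
open import Data.List.Membership.Propositional using () renaming (_∈_ to _∈ₗ_)
import Data.List.Membership.DecPropositional as DecMembership
open import Data.List.Relation.Unary.All using ([])
open import Data.List.Relation.Unary.All.Properties using (¬Any⇒All¬)
open import Data.List.Relation.Unary.Any using (here; there)
open import Data.List.Relation.Unary.AllPairs using ([]; _∷_)
open import Data.List.Relation.Unary.Unique.Propositional using (Unique)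
open import Data.Nat using (_+_; _∸_; _≤_; _<_; _≥_; z≤n; s≤s; s≤s⁻¹)
import Data.Nat.Properties as ℕ
open import Data.Product using (Σ-syntax; _×_; _,_; proj₁; proj₂)
open import Data.Sum using (_⊎_; inj₁; inj₂; [_,_]′)
open import Data.Vec using ([]; _∷_; here; there; tabulate)
open import Data.Vec.Properties using ([]=⇒lookup; lookup⇒[]=; lookup∘tabulate)
open import Function using (_∘_; Inverse; Injection)
open import Function.Properties.Inverse using (↔⇒↣)
open import Relation.Binary.Construct.Closure.ReflexiveTransitive using (ε; _◅_)
open import Relation.Binary.PropositionalEquality
  using (_≡_; _≢_; refl; sym; trans; cong; subst; subst₂)
open import Relation.Nullary using (¬_; yes; no; does; contradiction)
open import Relation.Nullary.Decidable using (dec-true; _×-dec_; _⊎-dec_)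
import Relation.Unary as U

open Graph using (V; order; index; vertex; vertex-index; finite)

-- Cardinalities of finite subsets.

x∉p-x : ∀ {n} (p : Subset n) x → x ∉ p - x
-- Deleting `x` twice is the same as deleting it once, yet deleting a member strictly lowers the
-- cardinality.
x∉p-x p x x∈ = ℕ.n≮n _ (subst (λ q → ∣ q ∣ < ∣ p - x ∣) (p─q─q≡p─q p ⁅ x ⁆) (x∈p⇒∣p-x∣<∣p∣ x∈))

∣p∣≤1+∣p-x∣ : ∀ {n} (p : Subset n) x → ∣ p ∣ ≤ 1 + ∣ p - x ∣
∣p∣≤1+∣p-x∣ (inside  ∷ p) zero    = s≤s (ℕ.≤-reflexive (cong ∣_∣ (sym (p─⊥≡p p))))
∣p∣≤1+∣p-x∣ (outside ∷ p) zero    = ℕ.m≤n⇒m≤1+n (ℕ.≤-reflexive (cong ∣_∣ (sym (p─⊥≡p p))))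
∣p∣≤1+∣p-x∣ (inside  ∷ p) (suc x) = s≤s (∣p∣≤1+∣p-x∣ p x)
∣p∣≤1+∣p-x∣ (outside ∷ p) (suc x) = ∣p∣≤1+∣p-x∣ p x

0<∣p∣⇒Nonempty : ∀ {n} (p : Subset n) → 0 < ∣ p ∣ → Nonempty p
0<∣p∣⇒Nonempty {n} p 0<∣p∣ with nonempty? p
... | yes ne = ne
... | no ¬ne = contradiction
  (subst (0 <_) (trans (cong ∣_∣ (Empty-unique ¬ne)) (∣⊥∣≡0 n)) 0<∣p∣) ℕ.n≮0

-- Each element of `p` uses up its own image: once `f zero` is deleted from `q`, the other images
-- survive by injectivity, and `r` survives because it avoids the image. The remainder `r` lets a
-- disjoint union be counted one piece at a time.
∣image∣+∣rest∣≤ : ∀ {m n} (p : Subset m) {r q : Subset n} (f : Fin m → Fin n) →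
  (∀ {i j} → f i ≡ f j → i ≡ j) →
  (∀ {i} → i ∈ p → f i ∈ q) → (∀ {i} → i ∈ p → f i ∉ r) → r ⊆ q →
  ∣ p ∣ + ∣ r ∣ ≤ ∣ q ∣
∣image∣+∣rest∣≤ []            f inj f∈q f∉r r⊆q = p⊆q⇒∣p∣≤∣q∣ r⊆q
∣image∣+∣rest∣≤ (outside ∷ p) f inj f∈q f∉r r⊆q =
  ∣image∣+∣rest∣≤ p (f ∘ suc) (suc-injective ∘ inj) (f∈q ∘ there) (f∉r ∘ there) r⊆q
∣image∣+∣rest∣≤ (inside ∷ p) {r} {q} f inj f∈q f∉r r⊆q = ℕ.≤-<-trans
  (∣image∣+∣rest∣≤ p {q = q - f zero} (f ∘ suc) (suc-injective ∘ inj)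
    (λ i∈p → x∈p∧x≢y⇒x∈p-y (f∈q (there i∈p)) (0≢1+n ∘ sym ∘ inj))
    (f∉r ∘ there)
    (λ x∈r → x∈p∧x≢y⇒x∈p-y (r⊆q x∈r) λ { refl → f∉r here x∈r }))
  (x∈p⇒∣p-x∣<∣p∣ (f∈q here))

-- Walks, geodesics and general position in one graph.

module _ (G : Graph) where
  open Graph G using (_≟_)
  open DecMembership _≟_ using () renaming (_∈?_ to _∈ₗ?_)

  index-injective : ∀ {u v} → index G u ≡ index G v → u ≡ v
  index-injective = Injection.injective (↔⇒↣ (finite G))

  index-vertex : ∀ i → index G (vertex G i) ≡ i
  index-vertex = Inverse.strictlyInverseˡ (finite G)

  vertex-injective : ∀ {i j} → vertex G i ≡ vertex G j → i ≡ j
  vertex-injective e = trans (sym (index-vertex _)) (trans (cong (index G) e) (index-vertex _))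

  module _ {P : V G → Set} (P? : U.Decidable P) where

    ⟦_⟧ : VertexSet G
    ⟦_⟧ = tabulate (does ∘ P? ∘ vertex G)

    ∈⟦⟧⁺ : ∀ {v} → P v → _∈ᵥ_ G v ⟦_⟧
    ∈⟦⟧⁺ {v} pv = lookup⇒[]= (index G v) ⟦_⟧ (trans (lookup∘tabulate _ (index G v))
      (dec-true (P? _) (subst P (sym (vertex-index G v)) pv)))

    ∈⟦⟧⁻ : ∀ {v} → _∈ᵥ_ G v ⟦_⟧ → P v
    -- The lookup equation is abstracted together with the decision, so that a negative answer turns
    -- it into an absurd equation of booleans.
    ∈⟦⟧⁻ {v} v∈ with P? (vertex G (index G v))
                   | trans (sym (lookup∘tabulate (does ∘ P? ∘ vertex G) (index G v))) ([]=⇒lookup v∈)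
    ... | yes p | _ = subst P (vertex-index G v) p
    ... | no _  | ()

  source∈ : ∀ {u v} (w : Walk G u v) → u ∈ₗ walkVertices {G} w
  source∈ ε       = here refl
  source∈ (_ ◅ _) = here refl

  -- Minimality is taken over all walks, not only paths, because projecting a path of a product may
  -- produce repeated vertices.
  Shortest : ∀ {u v} → Walk G u v → Set
  Shortest {u} {v} w = ∀ (w′ : Walk G u v) → walkLength {G} w ≤ walkLength {G} w′

  suffix : ∀ {u v x} (w : Walk G u v) → Unique (walkVertices {G} w) → x ∈ₗ walkVertices {G} w →
           Σ[ p ∈ Path G x v ] length {G} p ≤ walkLength {G} w
  suffix ε       uniq       (here refl) = (ε , uniq) , z≤n
  suffix (a ◅ w) uniq       (here refl) = (a ◅ w , uniq) , ℕ.≤-refl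
  suffix (a ◅ w) (_ ∷ uniq) (there x∈)  with p , p≤ ← suffix w uniq x∈ = p , ℕ.m≤n⇒m≤1+n p≤

  -- The tail is erased first; if the result meets the source `u` again, the path restarts from that
  -- occurrence.
  loopErase : ∀ {u v} (w : Walk G u v) → Σ[ p ∈ Path G u v ] length {G} p ≤ walkLength {G} w
  loopErase ε = (ε , [] ∷ []) , z≤n
  loopErase {u} (a ◅ w) with (w′ , uniq) , w′≤ ← loopErase w with u ∈ₗ? walkVertices {G} w′
  ... | no u∉  = (a ◅ w′ , ¬Any⇒All¬ _ u∉ ∷ uniq) , s≤s w′≤
  ... | yes u∈ with p , p≤ ← suffix w′ uniq u∈ = p , ℕ.m≤n⇒m≤1+n (ℕ.≤-trans p≤ w′≤)

  -- If the first vertex recurred, the suffix from its recurrence would be a strictly shorter walk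
  -- between the same ends.
  shortest⇒unique : ∀ {u v} (w : Walk G u v) → Shortest w → Unique (walkVertices {G} w)
  shortest⇒unique ε       _     = [] ∷ []
  shortest⇒unique (a ◅ w) short = ¬Any⇒All¬ _ u∉ ∷ uniq
    where
    -- The tail of a shortest walk is shortest, since any competitor can be prefixed with `a`.
    uniq = shortest⇒unique w (λ w′ → s≤s⁻¹ (short (a ◅ w′)))
    u∉ = λ u∈ → let ((w′ , _) , w′≤) = suffix w uniq u∈ in ℕ.n≮n _ (ℕ.≤-trans (short w′) w′≤)

  geodesic⇒shortest : ∀ {u v} (p : Path G u v) → IsGeodesic G p → Shortest (proj₁ p)
  geodesic⇒shortest p (_ , min) w with q , q≤ ← loopErase w = ℕ.≤-trans (min q) q≤

  shortest⇒liesOnGeodesic : ∀ {u v x} (w : Walk G u v) → Shortest w → x ∈ₗ walkVertices {G} w →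
                            LiesOnGeodesic G x u v
  shortest⇒liesOnGeodesic w short x∈ = p , ((p , refl) , short ∘ proj₁) , x∈
    where p = w , shortest⇒unique w short

  liesOnGeodesic-loop : ∀ {w u} → LiesOnGeodesic G w u u → w ≡ u
  liesOnGeodesic-loop ((ε , _) , _ , here e)        = e
  liesOnGeodesic-loop ((_ ◅ _ , _) , (_ , min) , _) = contradiction (min (ε , [] ∷ [])) ℕ.n≮0

  -- The case `u ≡ v` has to be covered, as distinct vertices of a product may agree in a
  -- coordinate; the geodesic is then trivial.
  generalPosition⇒endpoint : ∀ {S} → IsGeneralPosition G S → ∀ {u v w} →
    _∈ᵥ_ G u S → _∈ᵥ_ G v S → _∈ᵥ_ G w S → LiesOnGeodesic G w u v → w ≡ u ⊎ w ≡ v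
  generalPosition⇒endpoint gpS {u} {v} {w} u∈ v∈ w∈ btw with u ≟ v | w ≟ u | w ≟ v
  ... | yes refl | _       | _       = inj₁ (liesOnGeodesic-loop btw)
  ... | no _     | yes w≡u | _       = inj₁ w≡u
  ... | no _     | no _    | yes w≡v = inj₂ w≡v
  ... | no u≢v   | no w≢u  | no w≢v  = contradiction btw (gpS u v w u∈ v∈ w∈ u≢v w≢u w≢v)

  singleton-generalPosition : ∀ i → IsGeneralPosition G ⁅ i ⁆
  singleton-generalPosition i u v w u∈ v∈ _ u≢v _ _ _ =
    u≢v (index-injective (trans (x∈⁅y⁆⇒x≡y i u∈) (sym (x∈⁅y⁆⇒x≡y i v∈))))

  -- Singletons are in general position. Hence maximum general position sets are nonempty and offer
  -- an element at which to centre the cross.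
  0<gp : V G → 0 < gp G
  0<gp v = subst (_≤ gp G) (∣⁅x⁆∣≡1 (index G v))
    (proj₂ (gp-isGPNumber G) ⁅ index G v ⁆ (singleton-generalPosition (index G v)))

-- Projecting and recombining walks in the product.

module _ (G H : Graph) where
  private
    module G = Graph G
    module H = Graph H

  walk₁ : ∀ {u v} → Walk (G □ H) u v → Walk G (proj₁ u) (proj₁ v)
  walk₁ ε                     = ε
  walk₁ (inj₁ (a , _) ◅ w)    = a ◅ walk₁ w
  walk₁ (inj₂ (refl , _) ◅ w) = walk₁ w

  walk₂ : ∀ {u v} → Walk (G □ H) u v → Walk H (proj₂ u) (proj₂ v)
  walk₂ ε                     = ε
  walk₂ (inj₁ (_ , refl) ◅ w) = walk₂ w
  walk₂ (inj₂ (_ , a) ◅ w)    = a ◅ walk₂ w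

  -- Every edge of the product moves exactly one coordinate, so it is counted in exactly one
  -- projection.
  walkLength-split : ∀ {u v} (w : Walk (G □ H) u v) →
    walkLength {G □ H} w ≡ walkLength {G} (walk₁ w) + walkLength {H} (walk₂ w)
  walkLength-split ε                     = refl
  walkLength-split (inj₁ (_ , refl) ◅ w) = cong (1 +_) (walkLength-split w)
  walkLength-split (inj₂ (refl , _) ◅ w) =
    trans (cong (1 +_) (walkLength-split w)) (sym (ℕ.+-suc _ _))

  ∈-walk₁ : ∀ {u v x} (w : Walk (G □ H) u v) →
    x ∈ₗ walkVertices {G □ H} w → proj₁ x ∈ₗ walkVertices {G} (walk₁ w)
  ∈-walk₁ ε                     (here refl) = here refl
  ∈-walk₁ (inj₁ _ ◅ w)          (here refl) = here refl
  -- This edge fixes the first coordinate, so the projected vertex is the source of the projected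
  -- tail.
  ∈-walk₁ (inj₂ (refl , _) ◅ w) (here refl) = source∈ G (walk₁ w)
  ∈-walk₁ (inj₁ _ ◅ w)          (there x∈)  = there (∈-walk₁ w x∈)
  ∈-walk₁ (inj₂ (refl , _) ◅ w) (there x∈)  = ∈-walk₁ w x∈

  ∈-walk₂ : ∀ {u v x} (w : Walk (G □ H) u v) →
    x ∈ₗ walkVertices {G □ H} w → proj₂ x ∈ₗ walkVertices {H} (walk₂ w)
  ∈-walk₂ ε                     (here refl) = here refl
  ∈-walk₂ (inj₁ (_ , refl) ◅ w) (here refl) = source∈ H (walk₂ w)
  ∈-walk₂ (inj₂ _ ◅ w)          (here refl) = here refl
  ∈-walk₂ (inj₁ (_ , refl) ◅ w) (there x∈)  = ∈-walk₂ w x∈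
  ∈-walk₂ (inj₂ _ ◅ w)          (there x∈)  = there (∈-walk₂ w x∈)

  walk-□ : ∀ {g g′ h h′} → Walk G g g′ → Walk H h h′ → Walk (G □ H) (g , h) (g′ , h′)
  walk-□ (a ◅ v) w       = inj₁ (a , refl) ◅ walk-□ v w
  walk-□ ε       (a ◅ w) = inj₂ (refl , a) ◅ walk-□ ε w
  walk-□ ε       ε       = ε

  walkLength-□ : ∀ {g g′ h h′} (v : Walk G g g′) (w : Walk H h h′) →
    walkLength {G □ H} (walk-□ v w) ≡ walkLength {G} v + walkLength {H} w
  walkLength-□ (_ ◅ v) w       = cong (1 +_) (walkLength-□ v w)
  walkLength-□ ε       (_ ◅ w) = cong (1 +_) (walkLength-□ ε w)
  walkLength-□ ε       ε       = refl

  module _ {u v} (w : Walk (G □ H) u v) (short : Shortest (G □ H) w) where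

    private
      -- Any two walks in the factors recombine into a competitor of `w`. Keeping one projection of
      -- `w` and cancelling its length shows the other to be shortest.
      walk₁+walk₂≤ : ∀ w₁ w₂ → walkLength {G} (walk₁ w) + walkLength {H} (walk₂ w) ≤
                               walkLength {G} w₁ + walkLength {H} w₂
      walk₁+walk₂≤ w₁ w₂ =
        subst₂ _≤_ (walkLength-split w) (walkLength-□ w₁ w₂) (short (walk-□ w₁ w₂))

    walk₁-shortest : Shortest G (walk₁ w)
    walk₁-shortest w₁ = ℕ.+-cancelʳ-≤ _ _ _ (walk₁+walk₂≤ w₁ (walk₂ w))

    walk₂-shortest : Shortest H (walk₂ w)
    walk₂-shortest w₂ = ℕ.+-cancelˡ-≤ _ _ _ (walk₁+walk₂≤ (walk₁ w) w₂)

  liesOnGeodesic-proj : ∀ {w u v} → LiesOnGeodesic (G □ H) w u v →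
    LiesOnGeodesic G (proj₁ w) (proj₁ u) (proj₁ v) × LiesOnGeodesic H (proj₂ w) (proj₂ u) (proj₂ v)
  liesOnGeodesic-proj (p@(x , _) , geo , w∈) =
    shortest⇒liesOnGeodesic G (walk₁ x) (walk₁-shortest x short) (∈-walk₁ x w∈) ,
    shortest⇒liesOnGeodesic H (walk₂ x) (walk₂-shortest x short) (∈-walk₂ x w∈)
    where short = geodesic⇒shortest (G □ H) p geo

  -- The cross: general position and cardinality.

  module Cross {R : VertexSet G} {S : VertexSet H}
               (gpR : IsGeneralPosition G R) (gpS : IsGeneralPosition H S)
               {i : Fin (order G)} {j : Fin (order H)} (i∈R : i ∈ R) (j∈S : j ∈ S) where

    g : V G
    g = vertex G i

    h : V H
    h = vertex H j

    -- Removing `i` and `j` excludes the corner `(g , h)` from both arms, which makes them disjoint.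
    Row Column RowOrColumn : V (G □ H) → Set
    Row    (x , y) = index G x ∈ R - i × y ≡ h
    Column (x , y) = x ≡ g × index H y ∈ S - j
    RowOrColumn x  = Row x ⊎ Column x

    row? : U.Decidable Row
    row? (x , y) = (index G x ∈? R - i) ×-dec (y H.≟ h)

    column? : U.Decidable Column
    column? (x , y) = (x G.≟ g) ×-dec (index H y ∈? S - j)

    rowOrColumn? : U.Decidable RowOrColumn
    rowOrColumn? x = row? x ⊎-dec column? x

    column cross : VertexSet (G □ H)
    column = ⟦_⟧ (G □ H) column?
    cross  = ⟦_⟧ (G □ H) rowOrColumn?

    row-≢ : ∀ {x y} → Row (x , y) → x ≢ g
    row-≢ (x∈ , _) refl = x∉p-x R i (subst (_∈ R - i) (index-vertex G i) x∈)

    column-≢ : ∀ {x y} → Column (x , y) → y ≢ h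
    column-≢ (_ , y∈) refl = x∉p-x S j (subst (_∈ S - j) (index-vertex H j) y∈)

    cross⇒R×S : ∀ {x y} → RowOrColumn (x , y) → index G x ∈ R × index H y ∈ S
    cross⇒R×S (inj₁ (x∈ , refl)) = p─q⊆p R _ x∈ , subst (_∈ S) (sym (index-vertex H j)) j∈S
    cross⇒R×S (inj₂ (refl , y∈)) = subst (_∈ R) (sym (index-vertex G i)) i∈R , p─q⊆p S _ y∈

    -- Two row vertices share the second coordinate `h`, while a column vertex has first coordinate
    -- `g`, which the row avoids.
    row-determined : ∀ {w u} → Row w → RowOrColumn u → proj₁ w ≡ proj₁ u → w ≡ u
    row-determined (_ , refl) (inj₁ (_ , refl)) refl = refl
    row-determined row        (inj₂ (refl , _)) e    = contradiction e (row-≢ row)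

    column-determined : ∀ {w u} → Column w → RowOrColumn u → proj₂ w ≡ proj₂ u → w ≡ u
    column-determined (refl , _) (inj₂ (refl , _)) refl = refl
    column-determined col        (inj₁ (_ , refl)) e    = contradiction e (column-≢ col)

    cross-generalPosition : IsGeneralPosition (G □ H) cross
    cross-generalPosition u v w u∈ v∈ w∈ _ w≢u w≢v btw =
      endpoint (∈cross u∈) (∈cross v∈) (∈cross w∈)
      where
      ∈cross : ∀ {x} → _∈ᵥ_ (G □ H) x cross → RowOrColumn x
      ∈cross {x} = ∈⟦⟧⁻ (G □ H) rowOrColumn? {x}

      endpoint : RowOrColumn u → RowOrColumn v → ¬ RowOrColumn w
      endpoint cu cv (inj₁ row) =
        [ w≢u ∘ row-determined row cu , w≢v ∘ row-determined row cv ]′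
          (generalPosition⇒endpoint G gpR (proj₁ (cross⇒R×S cu)) (proj₁ (cross⇒R×S cv))
            (proj₁ (cross⇒R×S (inj₁ row))) (proj₁ (liesOnGeodesic-proj btw)))
      endpoint cu cv (inj₂ col) =
        [ w≢u ∘ column-determined col cu , w≢v ∘ column-determined col cv ]′
          (generalPosition⇒endpoint H gpS (proj₂ (cross⇒R×S cu)) (proj₂ (cross⇒R×S cv))
            (proj₂ (cross⇒R×S (inj₂ col))) (proj₂ (liesOnGeodesic-proj btw)))

    ∣S-j∣≤∣column∣ : ∣ S - j ∣ ≤ ∣ column ∣
    -- With the empty remainder the counting lemma is the bound for a plain injection.
    ∣S-j∣≤∣column∣ = ℕ.m+n≤o⇒m≤o ∣ S - j ∣ (∣image∣+∣rest∣≤ (S - j) {⊥}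
      (λ k → index (G □ H) (g , vertex H k))
      (vertex-injective H ∘ cong proj₂ ∘ index-injective (G □ H))
      (λ {k} k∈ → ∈⟦⟧⁺ (G □ H) column? (refl , subst (_∈ S - j) (sym (index-vertex H k)) k∈))
      (λ _ → ∉⊥)
      ⊥⊆)

    ∣R-i∣+∣column∣≤∣cross∣ : ∣ R - i ∣ + ∣ column ∣ ≤ ∣ cross ∣
    -- Here the column is the remainder; the row misses it because its first coordinates differ from
    -- `g`.
    ∣R-i∣+∣column∣≤∣cross∣ = ∣image∣+∣rest∣≤ (R - i)
      (λ k → index (G □ H) (vertex G k , h))
      (vertex-injective G ∘ cong proj₁ ∘ index-injective (G □ H))
      (λ k∈ → ∈⟦⟧⁺ (G □ H) rowOrColumn? (inj₁ (row k∈)))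
      (λ k∈ k∈col → row-≢ (row k∈) (proj₁ (∈⟦⟧⁻ (G □ H) column? k∈col)))
      (λ {k} k∈col → subst (_∈ cross) (index-vertex (G □ H) k)
        (∈⟦⟧⁺ (G □ H) rowOrColumn? (inj₂ (∈⟦⟧⁻ (G □ H) column?
          (subst (_∈ column) (sym (index-vertex (G □ H) k)) k∈col)))))
      where
      row : ∀ {k} → k ∈ R - i → Row (vertex G k , h)
      row {k} k∈ = subst (_∈ R - i) (sym (index-vertex G k)) k∈ , refl

    -- The constant 2 pays for `i` and `j`, one element lost from each factor.
    ∣R∣+∣S∣≤2+∣cross∣ : ∣ R ∣ + ∣ S ∣ ≤ 2 + ∣ cross ∣
    ∣R∣+∣S∣≤2+∣cross∣ = begin
      ∣ R ∣ + ∣ S ∣                     ≤⟨ ℕ.+-mono-≤ (∣p∣≤1+∣p-x∣ R i) (∣p∣≤1+∣p-x∣ S j) ⟩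
      (1 + ∣ R - i ∣) + (1 + ∣ S - j ∣) ≡⟨ ℕ.+-suc (1 + ∣ R - i ∣) ∣ S - j ∣ ⟩
      2 + (∣ R - i ∣ + ∣ S - j ∣)       ≤⟨ ℕ.+-monoʳ-≤ 2 (ℕ.+-monoʳ-≤ ∣ R - i ∣ ∣S-j∣≤∣column∣) ⟩
      2 + (∣ R - i ∣ + ∣ column ∣)      ≤⟨ ℕ.+-monoʳ-≤ 2 ∣R-i∣+∣column∣≤∣cross∣ ⟩
      2 + ∣ cross ∣                     ∎
      where open ℕ.≤-Reasoning

theorem3p1 : (G H : Graph) → Connected G → Connected H →
    gp (G □ H) ≥ (gp G + gp H) ∸ 2
theorem3p1 G H (x , _) (y , _) =
  let (R , gpR , ∣R∣≡) , _ = gp-isGPNumber G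
      (S , gpS , ∣S∣≡) , _ = gp-isGPNumber H
      i , i∈R = 0<∣p∣⇒Nonempty R (subst (0 <_) (sym ∣R∣≡) (0<gp G x))
      j , j∈S = 0<∣p∣⇒Nonempty S (subst (0 <_) (sym ∣S∣≡) (0<gp H y))
      open Cross G H gpR gpS i∈R j∈S
  -- The 2 is moved across the inequality, so truncated subtraction needs no case distinction.
  in ℕ.m≤n+o⇒m∸n≤o _ 2 (ℕ.≤-trans
      (subst₂ (λ r s → r + s ≤ 2 + ∣ cross ∣) ∣R∣≡ ∣S∣≡ ∣R∣+∣S∣≤2+∣cross∣)
      (ℕ.+-monoʳ-≤ 2 (proj₂ (gp-isGPNumber (G □ H)) cross cross-generalPosition)))
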